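{- Let $D$ be a decidable domain presented by a language $L$, let $L^{+}$ adjoin the parametrised gate $\mathrm{ask}(\cdot)$, and let $(a_k)_{k\in\mathbb{N}}$ be the iterates. For each $p$ there is a Boolean function $F_p:\{0,1\}^{Q(p)}\to\{0,1\}$, computable uniformly from $\nu(p)$, with $$a_{k+1}(p)=F_p\bigl(a_k\!\restriction\! Q(p)\bigr)\quad\text{for all }k.$$ Hence the hierarchy $(a_k)_k$ is the synchronous update of a Boolean network on the query graph (with each $p$ depending on the members of $Q(p)$), started at the all-zero state.
   Context: A domain $D$ presented by a language $L$ with a computable numbering of its systems has a manifestation predicate $\mathbf{M}_D$; it is decidable if it is decidable whether a given system manifests. $L^{+}$ is obtained from $L$ by adjoining a gate $\mathrm{ask}(q)$ with a parameter $q\in\mathbb{N}$; $L^+$ is a decidable set of finite syntactic objects with a fixed computable numbering $\nu:\mathbb{N}\to L^{+}$ extending that of $L$. Assigning a value in $\{0,1\}=\{\text{void},\text{mark}\}$ to every occurring gate turns a system of $L^+$ into a gate-free system of $L$, which is evaluated as in $L$. Iterates: $a_0(p)=0$ for all $p$; $a_{k+1}(p)=1$ if the system $\nu(p)$, evaluated with each occurrence of $\mathrm{ask}(q)$ returning $a_k(q)$, fails to manifest, and $a_{k+1}(p)=0$ otherwise. $Q(p)=\{q:\mathrm{ask}(q)\text{ occurs in }\nu(p)\}$ (a finite set). -}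

module Defs where

open import Data.Bool using (Bool; true; false; not)
open import Data.List using (List; []; _∷_; map; concatMap; mapMaybe; deduplicate)
open import Data.List.Relation.Unary.All using (All; reduce; universal)
open import Data.Nat using (ℕ; zero; suc; _<_; _≟_)
open import Data.Product using (Σ-syntax; ∃-syntax; _×_; _,_; proj₁; proj₂)
open import Data.Sum using (_⊎_; inj₁; inj₂; isInj₂; [_,_]′)
open import Function using (_⇔_)
open import Level using (0ℓ)
open import Relation.Binary.PropositionalEquality using (_≡_)
open import Relation.Nullary using (Dec; does; _because_; Reflects)
open import Relation.Unary using (Pred; U)

-- Partial recursive functions on hereditarily finite data.  On `nat` the
-- schemes are those of the μ-recursive functions; lists are primitive data with
-- their own recursion scheme, so that syntax needs no coding by numbers.

infixr 7 _×'_
infixr 6 _⊎'_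

data Ty : Set where
  bool nat  : Ty
  list      : Ty → Ty
  _×'_ _⊎'_ : Ty → Ty → Ty

⟦_⟧ : Ty → Set
⟦ bool ⟧   = Bool
⟦ nat ⟧    = ℕ
⟦ list σ ⟧ = List ⟦ σ ⟧
⟦ σ ×' τ ⟧ = ⟦ σ ⟧ × ⟦ τ ⟧
⟦ σ ⊎' τ ⟧ = ⟦ σ ⟧ ⊎ ⟦ τ ⟧

private variable
  ρ σ τ γ : Ty

infixr 9 _∙_

data Prog : Ty → Ty → Set where
  idP     : Prog σ σ
  _∙_     : Prog σ τ → Prog ρ σ → Prog ρ τ
  pairP   : Prog ρ σ → Prog ρ τ → Prog ρ (σ ×' τ)
  fstP    : Prog (σ ×' τ) σ
  sndP    : Prog (σ ×' τ) τ
  inlP    : Prog σ (σ ⊎' τ)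
  inrP    : Prog τ (σ ⊎' τ)
  caseP   : Prog (γ ×' σ) ρ → Prog (γ ×' τ) ρ → Prog (γ ×' (σ ⊎' τ)) ρ
  trueP   : Prog γ bool
  falseP  : Prog γ bool
  ifP     : Prog γ ρ → Prog γ ρ → Prog (γ ×' bool) ρ
  zeroP   : Prog γ nat
  sucP    : Prog nat nat
  recP    : Prog γ ρ → Prog (γ ×' nat ×' ρ) ρ → Prog (γ ×' nat) ρ
  nilP    : Prog γ (list σ)
  consP   : Prog (σ ×' list σ) (list σ)
  lrecP   : Prog γ ρ → Prog (γ ×' σ ×' list σ ×' ρ) ρ → Prog (γ ×' list σ) ρ
  μP      : Prog (γ ×' nat) bool → Prog γ nat

-- `P ⊢ x ⇓ y`: on input x the program P halts with output y.

infix 4 _⊢_⇓_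

data _⊢_⇓_ : Prog σ τ → ⟦ σ ⟧ → ⟦ τ ⟧ → Set where
  id⇓    : ∀ {x} → idP {σ} ⊢ x ⇓ x
  ∙⇓     : ∀ {P : Prog σ τ} {R : Prog ρ σ} {x y z} →
           R ⊢ x ⇓ y → P ⊢ y ⇓ z → P ∙ R ⊢ x ⇓ z
  pair⇓  : ∀ {P : Prog ρ σ} {R : Prog ρ τ} {x y z} →
           P ⊢ x ⇓ y → R ⊢ x ⇓ z → pairP P R ⊢ x ⇓ (y , z)
  fst⇓   : ∀ {x y} → fstP {σ} {τ} ⊢ (x , y) ⇓ x
  snd⇓   : ∀ {x y} → sndP {σ} {τ} ⊢ (x , y) ⇓ y
  inl⇓   : ∀ {x} → inlP {σ} {τ} ⊢ x ⇓ inj₁ x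
  inr⇓   : ∀ {y} → inrP {τ} {σ} ⊢ y ⇓ inj₂ y
  caseˡ⇓ : ∀ {P : Prog (γ ×' σ) ρ} {R : Prog (γ ×' τ) ρ} {c x z} →
           P ⊢ (c , x) ⇓ z → caseP P R ⊢ (c , inj₁ x) ⇓ z
  caseʳ⇓ : ∀ {P : Prog (γ ×' σ) ρ} {R : Prog (γ ×' τ) ρ} {c y z} →
           R ⊢ (c , y) ⇓ z → caseP P R ⊢ (c , inj₂ y) ⇓ z
  true⇓  : ∀ {c} → trueP {γ} ⊢ c ⇓ true
  false⇓ : ∀ {c} → falseP {γ} ⊢ c ⇓ false
  ifᵗ⇓   : ∀ {P R : Prog γ ρ} {c z} → P ⊢ c ⇓ z → ifP P R ⊢ (c , true) ⇓ z
  ifᶠ⇓   : ∀ {P R : Prog γ ρ} {c z} → R ⊢ c ⇓ z → ifP P R ⊢ (c , false) ⇓ z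
  zero⇓  : ∀ {c} → zeroP {γ} ⊢ c ⇓ zero
  suc⇓   : ∀ {n} → sucP ⊢ n ⇓ suc n
  recᶻ⇓  : ∀ {P : Prog γ ρ} {R : Prog (γ ×' nat ×' ρ) ρ} {c z} →
           P ⊢ c ⇓ z → recP P R ⊢ (c , zero) ⇓ z
  recˢ⇓  : ∀ {P : Prog γ ρ} {R : Prog (γ ×' nat ×' ρ) ρ} {c n y z} →
           recP P R ⊢ (c , n) ⇓ y → R ⊢ (c , n , y) ⇓ z →
           recP P R ⊢ (c , suc n) ⇓ z
  nil⇓   : ∀ {c} → nilP {γ} {σ} ⊢ c ⇓ []
  cons⇓  : ∀ {x xs} → consP {σ} ⊢ (x , xs) ⇓ (x ∷ xs)
  lrec⁰⇓ : ∀ {P : Prog γ ρ} {R : Prog (γ ×' σ ×' list σ ×' ρ) ρ} {c z} →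
           P ⊢ c ⇓ z → lrecP P R ⊢ (c , []) ⇓ z
  lrec⁺⇓ : ∀ {P : Prog γ ρ} {R : Prog (γ ×' σ ×' list σ ×' ρ) ρ} {c x xs y z} →
           lrecP P R ⊢ (c , xs) ⇓ y → R ⊢ (c , x , xs , y) ⇓ z →
           lrecP P R ⊢ (c , x ∷ xs) ⇓ z
  μ⇓     : ∀ {P : Prog (γ ×' nat) bool} {c n} →
           (∀ m → m < n → P ⊢ (c , m) ⇓ false) → P ⊢ (c , n) ⇓ true →
           μP P ⊢ c ⇓ n

Computable : ∀ σ τ → (⟦ σ ⟧ → ⟦ τ ⟧) → Set
Computable σ τ f = Σ[ P ∈ Prog σ τ ] (∀ x → P ⊢ x ⇓ f x)

-- One program decides A on the inputs satisfying S; it may diverge elsewhere.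

DecidableOn : ∀ σ → Pred ⟦ σ ⟧ 0ℓ → Pred ⟦ σ ⟧ 0ℓ → Set
DecidableOn σ S A =
  Σ[ P ∈ Prog σ bool ] (∀ x → S x → ∃[ b ] (P ⊢ x ⇓ b × Reflects (A x) b))

record ComputableNumbering (σ : Ty) (S : Pred ⟦ σ ⟧ 0ℓ) : Set where
  field
    index      : ℕ → ⟦ σ ⟧
    sound      : ∀ n → S (index n)
    onto       : ∀ x → S x → ∃[ n ] index n ≡ x
    computable : Computable nat σ index

-- Finite syntactic objects are words over a countable alphabet; in L⁺ the
-- alphabet also has the tokens ask(q), encoded as `inj₂ q`.

word word⁺ : Ty
word  = list nat
word⁺ = list (nat ⊎' nat)

gateFree : ⟦ word ⟧ → ⟦ word⁺ ⟧
gateFree = map inj₁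

-- `void` and `mark` are the words of L that a gate is replaced by.  `Manifests`
-- is only ever consulted on words belonging to `L`.

record Domain : Set₁ where
  field
    L         : Pred ⟦ word ⟧ 0ℓ
    numbering : ComputableNumbering word L
    void mark : ⟦ word ⟧
    Manifests : Pred ⟦ word ⟧ 0ℓ

  value : Bool → ⟦ word ⟧
  value false = void
  value true  = mark

  assign : (ℕ → Bool) → ⟦ word⁺ ⟧ → ⟦ word ⟧
  assign s = concatMap [ (λ x → x ∷ []) , (λ q → value (s q)) ]′

  ManifestationDecidable : Set
  ManifestationDecidable = DecidableOn word L Manifests

-- `ν` extends the numbering of L up to a computable translation of indices: both
-- numberings are total and onto, so they cannot agree index by index.

record AskExtension (D : Domain) : Set₁ where
  open Domain D
  field
    L⁺            : Pred ⟦ word⁺ ⟧ 0ℓ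
    L⁺-decidable  : DecidableOn word⁺ U L⁺
    L⁺-gateFree   : ∀ w → L⁺ (gateFree w) ⇔ L w
    L⁺-assign     : ∀ s w → L⁺ w → L (assign s w)
    ν-numbering   : ComputableNumbering word⁺ L⁺

  open ComputableNumbering ν-numbering public using () renaming (index to ν)

  field
    translate     : ℕ → ℕ
    translate-rec : Computable nat nat translate
    ν-extends     : ∀ n → ν (translate n)
                        ≡ gateFree (ComputableNumbering.index numbering n)

-- A locally finite digraph on ℕ, given by its lists of out-neighbours.

Digraph : Set
Digraph = ℕ → List ℕ

-- {0,1}^X for a repetition-free list X.

𝔹^_ : List ℕ → Set
𝔹^ X = All (λ _ → Bool) X

infix 8 𝔹^_

_↾_ : (ℕ → Bool) → (X : List ℕ) → 𝔹^ X
s ↾ X = universal s X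

graph : ∀ {X} → 𝔹^ X → List (ℕ × Bool)
graph = reduce (λ {q} b → q , b)

-- The vertex p reads the states of its out-neighbours.

BooleanNetwork : Digraph → Set
BooleanNetwork G = ∀ p → 𝔹^ G p → Bool

update : ∀ {G} → BooleanNetwork G → (ℕ → Bool) → (ℕ → Bool)
update {G} F s p = F p (s ↾ G p)

trajectory : ∀ {G} → BooleanNetwork G → (ℕ → Bool) → ℕ → (ℕ → Bool)
trajectory F s zero    = s
trajectory F s (suc k) = update F (trajectory F s k)

allZero : ℕ → Bool
allZero _ = false

module Hierarchy (D : Domain) (D? : Domain.ManifestationDecidable D)
                 (E : AskExtension D) where
  open Domain D
  open AskExtension E

  manifests? : ∀ w → L w → Dec (Manifests w)
  manifests? w w∈L =
    let b , _ , r = proj₂ D? w w∈L in b because r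

  evaluated : ∀ s p → Dec (Manifests (assign s (ν p)))
  evaluated s p = manifests? (assign s (ν p))
    (L⁺-assign s (ν p) (ComputableNumbering.sound ν-numbering p))

  a : ℕ → ℕ → Bool
  a zero    p = false
  a (suc k) p = not (does (evaluated (a k) p))

  Q : ℕ → List ℕ
  Q p = deduplicate _≟_ (mapMaybe isInj₂ (ν p))

  queryGraph : Digraph
  queryGraph = Q

  -- A single program for all p, taking the system ν(p) itself and an element of
  -- {0,1}^Q(p), the latter presented by its graph.

  UniformlyComputable : (∀ p → 𝔹^ Q p → Bool) → Set
  UniformlyComputable F =
    Σ[ P ∈ Prog (word⁺ ×' list (nat ×' bool)) bool ]
      (∀ p (x : 𝔹^ Q p) → P ⊢ (ν p , graph x) ⇓ F p x)

{-# OPTIONS --safe #-}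

-- Let F_p(x) be the negated verdict on ν(p) when every gate ask(q) is answered
-- by looking q up in the graph of x.  Only the answers at the q occurring in
-- ν(p) enter the evaluated system, so F_p(s ↾ Q(p)) is the negated verdict
-- under s.  A program for F substitutes the answers, which is primitive
-- recursive, and then runs the decision procedure of D.

module Submission where

open import Defs
open import Data.Bool using (Bool; true; false; not; _∧_; if_then_else_)
open import Data.List using (List; []; _∷_; _++_; mapMaybe)
open import Data.List.Membership.Propositional using (_∈_)
open import Data.List.Membership.Propositional.Properties using (∈-deduplicate⁺)
open import Data.List.Relation.Unary.All using (_∷_)
open import Data.List.Relation.Unary.Any using (here; there)
open import Data.Nat using (ℕ; zero; suc; pred; _∸_; _≡ᵇ_; _≟_)
open import Data.Nat.Properties using (pred[m∸n]≡m∸[1+n])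
open import Data.Product using (Σ-syntax; _×_; _,_; proj₁; proj₂)
open import Data.Sum using (inj₁; inj₂; isInj₂; [_,_]′)
open import Relation.Binary.PropositionalEquality using (_≡_; refl; sym; trans; cong; cong₂; subst)
open import Relation.Nullary using (does; yes; no; contradiction)
open import Relation.Nullary.Decidable using (dec-true; dec-false; does-≡)

private variable
  ρ σ τ γ : Ty

infixr 9 _∘ᶜ_

-- Programs are assembled together with their halting proofs, so no derivation of `_⊢_⇓_` for a
-- composite has to be written by hand.
_∘ᶜ_ : ∀ {f g} → Computable σ τ f → Computable ρ σ g → Computable ρ τ (λ x → f (g x))
(P , p) ∘ᶜ (R , r) = P ∙ R , λ x → ∙⇓ (r x) (p _)

pairᶜ : ∀ {f g} → Computable ρ σ f → Computable ρ τ g →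
        Computable ρ (σ ×' τ) (λ x → f x , g x)
pairᶜ (P , p) (R , r) = pairP P R , λ x → pair⇓ (p x) (r x)

idᶜ : Computable σ σ (λ x → x)
idᶜ = idP , λ _ → id⇓

fstᶜ : Computable (σ ×' τ) σ proj₁
fstᶜ = fstP , λ _ → fst⇓

sndᶜ : Computable (σ ×' τ) τ proj₂
sndᶜ = sndP , λ _ → snd⇓

caseᶜ : ∀ {f g} → Computable (γ ×' σ) ρ f → Computable (γ ×' τ) ρ g →
        Computable (γ ×' (σ ⊎' τ)) ρ
          (λ (c , s) → [ (λ x → f (c , x)) , (λ y → g (c , y)) ]′ s)
caseᶜ (P , p) (R , r) = caseP P R , λ where
  (c , inj₁ x) → caseˡ⇓ (p (c , x))
  (c , inj₂ y) → caseʳ⇓ (r (c , y))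

ifᶜ : ∀ {b f g} → Computable γ bool b → Computable γ ρ f → Computable γ ρ g →
      Computable γ ρ (λ c → if b c then f c else g c)
ifᶜ {γ} {ρ} {_} {f} {g} b (P , p) (R , r) = branch ∘ᶜ pairᶜ idᶜ b
  where
  branch : Computable (γ ×' bool) ρ (λ (c , b) → if b then f c else g c)
  branch = ifP P R , λ where
    (c , true)  → ifᵗ⇓ (p c)
    (c , false) → ifᶠ⇓ (r c)

trueᶜ : Computable γ bool (λ _ → true)
trueᶜ = trueP , λ _ → true⇓

falseᶜ : Computable γ bool (λ _ → false)
falseᶜ = falseP , λ _ → false⇓

consᶜ : ∀ {f g} → Computable γ σ f → Computable γ (list σ) g →
        Computable γ (list σ) (λ c → f c ∷ g c)
consᶜ f g = (consP , λ _ → cons⇓) ∘ᶜ pairᶜ f g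

nilᶜ : Computable γ (list σ) (λ _ → [])
nilᶜ = nilP , λ _ → nil⇓

-- Only the recursion equations are asked of `h`, so a function defined elsewhere by pattern
-- matching can be certified as it stands.
recᶜ : ∀ {f g} {h : ⟦ γ ⟧ × ℕ → ⟦ ρ ⟧} →
       Computable γ ρ f → Computable (γ ×' nat ×' ρ) ρ g →
       (∀ c → f c ≡ h (c , zero)) →
       (∀ c n → g (c , n , h (c , n)) ≡ h (c , suc n)) →
       Computable (γ ×' nat) ρ h
recᶜ {h = h} (P , p) (R , r) h0 h+ = recP P R , λ (c , n) → run c n
  where
  run : ∀ c n → recP P R ⊢ (c , n) ⇓ h (c , n)
  run c zero    = recᶻ⇓ (subst (P ⊢ c ⇓_) (h0 c) (p c))
  run c (suc n) = recˢ⇓ (run c n) (subst (R ⊢ _ ⇓_) (h+ c n) (r _))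

lrecᶜ : ∀ {f g} {h : ⟦ γ ⟧ × List ⟦ σ ⟧ → ⟦ ρ ⟧} →
        Computable γ ρ f → Computable (γ ×' σ ×' list σ ×' ρ) ρ g →
        (∀ c → f c ≡ h (c , [])) →
        (∀ c x xs → g (c , x , xs , h (c , xs)) ≡ h (c , x ∷ xs)) →
        Computable (γ ×' list σ) ρ h
lrecᶜ {h = h} (P , p) (R , r) h0 h+ = lrecP P R , λ (c , xs) → run c xs
  where
  run : ∀ c xs → lrecP P R ⊢ (c , xs) ⇓ h (c , xs)
  run c []       = lrec⁰⇓ (subst (P ⊢ c ⇓_) (h0 c) (p c))
  run c (x ∷ xs) = lrec⁺⇓ (run c xs) (subst (R ⊢ _ ⇓_) (h+ c x xs) (r _))

respᶜ : ∀ {f g} → (∀ x → f x ≡ g x) → Computable σ τ f → Computable σ τ g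
respᶜ f≗g (P , p) = P , λ x → subst (P ⊢ x ⇓_) (f≗g x) (p x)

natᶜ : ∀ n → Computable γ nat (λ _ → n)
natᶜ zero    = zeroP , λ _ → zero⇓
natᶜ (suc n) = (sucP , λ _ → suc⇓) ∘ᶜ natᶜ n

wordᶜ : ∀ w → Computable γ word (λ _ → w)
wordᶜ []      = nilᶜ
wordᶜ (n ∷ w) = consᶜ (natᶜ n) (wordᶜ w)

notᶜ : Computable bool bool not
notᶜ = respᶜ (λ { true → refl ; false → refl }) (ifᶜ idᶜ falseᶜ trueᶜ)

predᶜ : Computable nat nat pred
predᶜ = recᶜ {h = λ (_ , n) → pred n} (natᶜ 0) (fstᶜ ∘ᶜ sndᶜ) (λ _ → refl) (λ _ _ → refl)
        -- The scheme demands a parameter; the input itself is duplicated as a dummy.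
        ∘ᶜ pairᶜ idᶜ idᶜ

∸ᶜ : Computable (nat ×' nat) nat (λ (m , n) → m ∸ n)
∸ᶜ = recᶜ idᶜ (predᶜ ∘ᶜ sndᶜ ∘ᶜ sndᶜ) (λ _ → refl) pred[m∸n]≡m∸[1+n]

zero?ᶜ : Computable nat bool (_≡ᵇ 0)
zero?ᶜ = recᶜ {h = λ (_ , n) → n ≡ᵇ 0} trueᶜ falseᶜ (λ _ → refl) (λ _ _ → refl)
         ∘ᶜ pairᶜ idᶜ idᶜ

-- Primitive recursion descends in one argument with the other fixed, whereas `_≡ᵇ_` descends in
-- both; two truncated differences avoid this.
≡ᵇ-via-∸ : ∀ m n → ((m ∸ n) ≡ᵇ 0) ∧ ((n ∸ m) ≡ᵇ 0) ≡ (m ≡ᵇ n)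
≡ᵇ-via-∸ zero    zero    = refl
≡ᵇ-via-∸ zero    (suc n) = refl
≡ᵇ-via-∸ (suc m) zero    = refl
≡ᵇ-via-∸ (suc m) (suc n) = ≡ᵇ-via-∸ m n

∧-if : ∀ b c → (if b then c else false) ≡ b ∧ c
∧-if true  c = refl
∧-if false c = refl

≟ᶜ : Computable (nat ×' nat) bool (λ (m , n) → does (m ≟ n))
-- `does (m ≟ n)` unfolds to `m ≡ᵇ n`.
≟ᶜ = respᶜ (λ (m , n) → trans (∧-if ((m ∸ n) ≡ᵇ 0) _) (≡ᵇ-via-∸ m n))
       (ifᶜ (zero?ᶜ ∘ᶜ ∸ᶜ) (zero?ᶜ ∘ᶜ ∸ᶜ ∘ᶜ pairᶜ sndᶜ fstᶜ) falseᶜ)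

++ᶜ : ∀ {f g} → Computable γ (list σ) f → Computable γ (list σ) g →
      Computable γ (list σ) (λ c → f c ++ g c)
++ᶜ f g =
  lrecᶜ {h = λ (ys , xs) → xs ++ ys} idᶜ
    (consᶜ (fstᶜ ∘ᶜ sndᶜ) (sndᶜ ∘ᶜ sndᶜ ∘ᶜ sndᶜ)) (λ _ → refl) (λ _ _ _ → refl)
  ∘ᶜ pairᶜ g f

-- The default `false` extends a finite graph to the total answer function that `assign` takes; for
-- a graph over `Q p`, no gate of `ν p` reaches it.
lookup : List (ℕ × Bool) → ℕ → Bool
lookup []            q = false
lookup ((r , b) ∷ g) q = if does (r ≟ q) then b else lookup g q

lookupᶜ : Computable (nat ×' list (nat ×' bool)) bool (λ (q , g) → lookup g q)
lookupᶜ = lrecᶜ falseᶜ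
  (ifᶜ (≟ᶜ ∘ᶜ pairᶜ (fstᶜ ∘ᶜ fstᶜ ∘ᶜ sndᶜ) fstᶜ)
       (sndᶜ ∘ᶜ fstᶜ ∘ᶜ sndᶜ)
       (sndᶜ ∘ᶜ sndᶜ ∘ᶜ sndᶜ))
  (λ _ → refl) (λ _ _ _ → refl)

-- Every entry with key `q` carries `s q`, so the first hit is correct even if `X` has repetitions.
lookup-graph : ∀ s {X q} → q ∈ X → lookup (graph (s ↾ X)) q ≡ s q
lookup-graph s {r ∷ X} {q} q∈ with r ≟ q | q∈
... | yes r≡q | _         rewrite dec-true (r ≟ q) r≡q = cong s r≡q
... | no r≢q  | here q≡r  = contradiction (sym q≡r) r≢q
... | no r≢q  | there q∈X rewrite dec-false (r ≟ q) r≢q = lookup-graph s q∈X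

-- States agree only pointwise, but their restrictions are finite tuples and hence equal outright,
-- without function extensionality.
↾-cong : ∀ {s t} → (∀ q → s q ≡ t q) → ∀ X → s ↾ X ≡ t ↾ X
↾-cong s≗t []      = refl
↾-cong s≗t (q ∷ X) = cong₂ _∷_ (s≗t q) (↾-cong s≗t X)

trajectory-unique : ∀ {G} (F : BooleanNetwork G) (s : ℕ → ℕ → Bool) →
                    (∀ k p → s (suc k) p ≡ F p (s k ↾ G p)) →
                    ∀ k p → s k p ≡ trajectory F (s 0) k p
trajectory-unique F s step zero    p = refl
trajectory-unique F s step (suc k) p =
  trans (step k p) (cong (F p) (↾-cong (trajectory-unique F s step k) _))

module _ (D : Domain) where
  open Domain D

  assign-cong : ∀ {s t} w → (∀ {q} → q ∈ mapMaybe isInj₂ w → s q ≡ t q) →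
                assign s w ≡ assign t w
  assign-cong []           s≗t = refl
  assign-cong (inj₁ x ∷ w) s≗t = cong (x ∷_) (assign-cong w s≗t)
  assign-cong (inj₂ q ∷ w) s≗t =
    cong₂ _++_ (cong value (s≗t (here refl))) (assign-cong w (λ r∈ → s≗t (there r∈)))

  valueᶜ : Computable bool word value
  valueᶜ = respᶜ (λ { true → refl ; false → refl }) (ifᶜ idᶜ (wordᶜ mark) (wordᶜ void))

  assignᶜ : Computable (word⁺ ×' list (nat ×' bool)) word (λ (w , g) → assign (lookup g) w)
  assignᶜ =
    lrecᶜ {h = λ (g , w) → assign (lookup g) w} nilᶜ
      (++ᶜ (tokenᶜ ∘ᶜ pairᶜ fstᶜ (fstᶜ ∘ᶜ sndᶜ)) (sndᶜ ∘ᶜ sndᶜ ∘ᶜ sndᶜ))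
      (λ _ → refl) (λ { _ (inj₁ _) _ → refl ; _ (inj₂ _) _ → refl })
    ∘ᶜ pairᶜ sndᶜ fstᶜ
    where
    tokenᶜ : Computable (list (nat ×' bool) ×' (nat ⊎' nat)) word
               (λ (g , t) → [ (λ x → x ∷ []) , (λ q → value (lookup g q)) ]′ t)
    tokenᶜ = caseᶜ (consᶜ sndᶜ nilᶜ) (valueᶜ ∘ᶜ lookupᶜ ∘ᶜ pairᶜ sndᶜ fstᶜ)

  module _ (D? : ManifestationDecidable) (E : AskExtension D) where
    open AskExtension E
    open Hierarchy D D? E

    -- The verdict also takes the membership proof as an argument, so equal words
    -- alone do not suffice; `Reflects` makes the proof irrelevant.
    manifests?-cong : ∀ {w w′} → w ≡ w′ → (m : L w) (m′ : L w′) →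
                      does (manifests? w m) ≡ does (manifests? w′ m′)
    manifests?-cong refl m m′ = does-≡ (manifests? _ m) (manifests? _ m′)

    F : ∀ p → 𝔹^ Q p → Bool
    F p x = not (does (evaluated (lookup (graph x)) p))

    F-computable : UniformlyComputable F
    F-computable =
      proj₁ notᶜ ∙ proj₁ D? ∙ proj₁ assignᶜ , λ p x →
        -- Halting is promised only on `L`. The membership proof inferred here is the one inside
        -- `evaluated`, so the run ends in the very bit that `F p x` negates.
        let _ , run , _ = proj₂ D? (assign (lookup (graph x)) (ν p)) _
        in ∙⇓ (∙⇓ (proj₂ assignᶜ (ν p , graph x)) run) (proj₂ notᶜ _)

    -- Stated for an arbitrary state; `s = a k` then gives both the one-step equation and the
    -- trajectory.
    F-restrict : ∀ s p → not (does (evaluated s p)) ≡ F p (s ↾ Q p)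
    F-restrict s p = cong not (manifests?-cong
      -- Gates are met with repetitions in `ν p` but listed once in `Q p`; deduplication keeps
      -- membership.
      (assign-cong (ν p) (λ q∈ → sym (lookup-graph s (∈-deduplicate⁺ _≟_ q∈)))) _ _)

lemma5p2 : (D : Domain) (D? : Domain.ManifestationDecidable D) (E : AskExtension D) →
    let open Hierarchy D D? E in
    Σ[ F ∈ (∀ p → 𝔹^ Q p → Bool) ]
    ( UniformlyComputable F
    × (∀ p k → a (suc k) p ≡ F p (a k ↾ Q p))
    × (∀ k p → a k p ≡ trajectory {queryGraph} F allZero k p) )
lemma5p2 D D? E =
  F D D? E , F-computable D D? E , (λ p k → F-restrict D D? E (a k) p) ,
  -- `a 0` is `allZero` by definition, which fixes the initial state.
  trajectory-unique (F D D? E) a (λ k → F-restrict D D? E (a k))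
  where open Hierarchy D D? E
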